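{- Let $G$ be a finite simple bipartite graph with at least one edge, with bipartition $(X,Y)$, such that all vertices of $X$ have the same degree and all vertices of $Y$ have the same degree (i.e. $G$ is biregular). Then $G$ admits an antimagic orientation.
   Context: For a directed graph $D$ with $m$ arcs, an antimagic labeling is a bijection from the set of arcs of $D$ to $\{1,2,\dots,m\}$ such that the oriented vertex sums of all vertices are pairwise distinct, where the oriented vertex sum at a vertex $v$ is the sum of the labels of all arcs entering $v$ minus the sum of the labels of all arcs leaving $v$. An undirected graph $G$ admits an antimagic orientation if some orientation of $G$ has an antimagic labeling. -}

module Defs where

open import Data.Nat using (ℕ; zero; suc; _+_; _<_)
open import Data.Integer as ℤ using (ℤ; +_)
open import Data.Fin using (Fin; zero; suc; toℕ)
open import Data.Bool using (Bool; true; false; if_then_else_)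
open import Data.Product using (_×_; _,_; proj₁; proj₂; Σ; ∃)
open import Relation.Binary.PropositionalEquality using (_≡_; _≢_)
open import Relation.Nullary using (¬_)
open import Relation.Nullary.Decidable using (⌊_⌋)
open import Data.Fin using (_≟_)
open import Function.Bundles using (_⤖_; Bijection)
open import Data.Sum using (_⊎_)

Σℕ : ∀ {m} → (Fin m → ℕ) → ℕ
Σℕ {zero}  f = 0
Σℕ {suc m} f = f zero + Σℕ (λ i → f (suc i))

Σℤ : ∀ {m} → (Fin m → ℤ) → ℤ
Σℤ {zero}  f = + 0
Σℤ {suc m} f = f zero ℤ.+ Σℤ (λ i → f (suc i))

record Graph (n m : ℕ) : Set where
  field
    ends : Fin m → Fin n × Fin n

open Graph public

SameEdge : ∀ {n} → Fin n × Fin n → Fin n × Fin n → Set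
SameEdge (a , b) (c , d) = ((a ≡ c) × (b ≡ d)) ⊎ ((a ≡ d) × (b ≡ c))

IsSimple : ∀ {n m} → Graph n m → Set
IsSimple {n} {m} G =
  (∀ (e : Fin m) → proj₁ (ends G e) ≢ proj₂ (ends G e)) ×
  (∀ (e f : Fin m) → SameEdge (ends G e) (ends G f) → e ≡ f)

incident : ∀ {n m} → Graph n m → Fin n → Fin m → ℕ
incident G v e =
  (if ⌊ proj₁ (ends G e) ≟ v ⌋ then 1 else 0) +
  (if ⌊ proj₂ (ends G e) ≟ v ⌋ then 1 else 0)

degree : ∀ {n m} → Graph n m → Fin n → ℕ
degree G v = Σℕ (incident G v)

-- Bipartition (X,Y): side v = true means v ∈ X, false means v ∈ Y;
-- every edge joins X and Y.
IsBipartition : ∀ {n m} → Graph n m → (Fin n → Bool) → Set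
IsBipartition {n} {m} G side =
  ∀ (e : Fin m) → side (proj₁ (ends G e)) ≢ side (proj₂ (ends G e))

IsBiregular : ∀ {n m} → Graph n m → (Fin n → Bool) → Set
IsBiregular {n} G side =
  ∀ (u v : Fin n) → side u ≡ side v → degree G u ≡ degree G v

Orientation : ℕ → Set
Orientation m = Fin m → Bool

head tail : ∀ {n m} → Graph n m → Orientation m → Fin m → Fin n
head G o e = if o e then proj₂ (ends G e) else proj₁ (ends G e)
tail G o e = if o e then proj₁ (ends G e) else proj₂ (ends G e)

-- Labeling: a bijection from arcs to {1,…,m}, encoded as Fin m ⤖ Fin m,
-- with arc e receiving label 1 + toℕ (L e).
-- Oriented vertex sum: (labels of arcs entering v) − (labels of arcs leaving v).
vertexSum : ∀ {n m} → Graph n m → Orientation m → (Fin m → Fin m) → Fin n → ℤ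
vertexSum G o L v = Σℤ (λ e →
  (if ⌊ head G o e ≟ v ⌋ then + suc (toℕ (L e)) else + 0) ℤ.-
  (if ⌊ tail G o e ≟ v ⌋ then + suc (toℕ (L e)) else + 0))

IsAntimagicLabeling : ∀ {n m} → Graph n m → Orientation m → (Fin m ⤖ Fin m) → Set
IsAntimagicLabeling {n} G o L =
  ∀ (u v : Fin n) → vertexSum G o (Bijection.to L) u ≡ vertexSum G o (Bijection.to L) v → u ≡ v

HasAntimagicOrientation : ∀ {n m} → Graph n m → Set
HasAntimagicOrientation {n} {m} G =
  Σ (Orientation m) λ o → Σ (Fin m ⤖ Fin m) λ L → IsAntimagicLabeling G o L

{-# OPTIONS --safe #-}
module Submission where

-- Orient every edge from X to Y: sums are negative on X and positive on Y, so only
-- vertices on the same side can collide. As in a breadth-first search, give each vertex a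
-- depth whose parity is its side, such that adjacent depths differ by 1 and every vertex
-- that shares its depth has a neighbour (parent) one level up. Let deeper edges have
-- smaller labels. Two vertices on the same side at different depths have depths differing
-- by at least 2, so all labels at the deeper one are below all labels at the other, and
-- having equal degrees they have different sums. Within a depth k, swapping the labels of
-- the parent edges of two vertices changes no other sum at depth ≥ k, and it raises the sum
-- of squared vertex sums at depth k if the two vertices were tied; hence the ties can be
-- removed level by level, from the deepest one upwards.

open import Defs
open import Data.Nat hiding (_≟_; parity)
open import Data.Nat.Properties hiding (_≟_; suc-injective)
open import Data.Nat.Induction using (<-wellFounded)
open import Data.Nat.Tactic.RingSolver using (solve-∀)
import Data.Nat.Properties as ℕ
import Data.Integer as ℤ
import Data.Integer.Properties as ℤ
open import Data.Bool using (Bool; true; false; not; if_then_else_)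
import Data.Bool as Bool
import Data.Bool.Properties as Bool
open import Data.Fin using (Fin; zero; suc; toℕ; _≟_)
open import Data.Fin.Properties using (any?; toℕ-injective; toℕ<n; injective⇒≤; suc-injective)
open import Data.Fin.Permutation using (Permutation′; _⟨$⟩ʳ_; _⟨$⟩ˡ_; _∘ₚ_; transpose; inverseˡ)
import Data.Fin.Permutation as Perm
open import Data.Product using (_×_; _,_; proj₁; proj₂; ∃)
open import Data.Sum using (_⊎_; inj₁; inj₂)
import Data.Sum as Sum
open import Data.Vec.Functional using (updateAt)
open import Data.Vec.Functional.Properties using (updateAt-updates; updateAt-minimal)
open import Function using (_∘_; const; case_of_)
open import Function.Properties.Inverse using (↔⇒⤖)
open import Induction.WellFounded using (Acc; acc)
open import Relation.Binary.PropositionalEquality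
open import Relation.Binary.Definitions using (tri<; tri≈; tri>)
open import Relation.Nullary using (Dec; yes; no; does; ¬_; contradiction)
open import Relation.Nullary.Decidable using (⌊_⌋; dec-true; dec-false; decidable-stable; ¬?; _×-dec_)

-- Local search with a natural-number potential

-- Well-foundedness of `<` stops the search. The sorting of labels uses this form; the raising of
-- depths and the removal of ties use `ascent`.
descent : ∀ {a g} {A : Set a} {Good : A → Set g} (Φ : A → ℕ) →
  (∀ x → Good x ⊎ ∃ λ y → Φ y < Φ x) → A → ∃ Good
descent {A = A} {Good} Φ step x = go x (<-wellFounded (Φ x))
  where
  go : ∀ x → Acc _<_ (Φ x) → ∃ Good
  go x (acc rs) with step x
  ... | inj₁ good    = x , good
  ... | inj₂ (y , p) = go y (rs p)

ascent : ∀ {a g} {A : Set a} {Good : A → Set g} (Φ : A → ℕ) B → (∀ x → Φ x ≤ B) →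
  (∀ x → Good x ⊎ ∃ λ y → Φ x < Φ y) → A → ∃ Good
ascent Φ B Φ≤B step = descent (λ x → B ∸ Φ x)
  (λ x → Sum.map₂ (λ { (y , p) → y , ∸-monoʳ-< p (Φ≤B y) }) (step x))

-- Finite sums of natural numbers

Σ-cong : ∀ {m} {f g : Fin m → ℕ} → (∀ i → f i ≡ g i) → Σℕ f ≡ Σℕ g
Σ-cong {zero}  eq = refl
Σ-cong {suc m} eq = cong₂ _+_ (eq zero) (Σ-cong (eq ∘ suc))

Σ-mono-≤ : ∀ {m} {f g : Fin m → ℕ} → (∀ i → f i ≤ g i) → Σℕ f ≤ Σℕ g
Σ-mono-≤ {zero}  le = z≤n
Σ-mono-≤ {suc m} le = +-mono-≤ (le zero) (Σ-mono-≤ (le ∘ suc))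

Σ-const : ∀ m c → Σℕ {m} (const c) ≡ m * c
Σ-const zero    c = refl
Σ-const (suc m) c = cong (c +_) (Σ-const m c)

Σ-bounded : ∀ {m} {f : Fin m → ℕ} c → (∀ i → f i ≤ c) → Σℕ f ≤ m * c
Σ-bounded {m} c le = ≤-trans (Σ-mono-≤ le) (≤-reflexive (Σ-const m c))

Σ-*ˡ : ∀ {m} c (f : Fin m → ℕ) → Σℕ (λ i → c * f i) ≡ c * Σℕ f
Σ-*ˡ {zero}  c f = sym (*-zeroʳ c)
Σ-*ˡ {suc m} c f = trans (cong (c * f zero +_) (Σ-*ˡ c (f ∘ suc))) (sym (*-distribˡ-+ c (f zero) _))

≤-Σ : ∀ {m} (f : Fin m → ℕ) i → f i ≤ Σℕ f
≤-Σ f zero    = m≤m+n _ _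
≤-Σ f (suc i) = ≤-trans (≤-Σ (f ∘ suc) i) (m≤n+m _ _)

-- Only the term at `i` can differ. The additive form avoids truncated subtraction.
Σ-exchange₁ : ∀ {m} {f g : Fin m → ℕ} i → (∀ j → j ≢ i → f j ≡ g j) →
  Σℕ f + g i ≡ Σℕ g + f i
Σ-exchange₁ {f = f} {g} zero agree = begin
  (f zero + Σℕ (f ∘ suc)) + g zero ≡⟨ cong (λ s → (f zero + s) + g zero) (Σ-cong λ j → agree (suc j) λ ()) ⟩
  (f zero + Σℕ (g ∘ suc)) + g zero ≡⟨ lem (f zero) (g zero) (Σℕ (g ∘ suc)) ⟩
  (g zero + Σℕ (g ∘ suc)) + f zero ∎
  where
  open ≡-Reasoning
  lem : ∀ a b c → (a + c) + b ≡ (b + c) + a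
  lem = solve-∀
Σ-exchange₁ {f = f} {g} (suc i) agree = begin
  (f zero + Σℕ (f ∘ suc)) + g (suc i) ≡⟨ +-assoc (f zero) _ _ ⟩
  f zero + (Σℕ (f ∘ suc) + g (suc i)) ≡⟨ cong₂ _+_ (agree zero λ ()) (Σ-exchange₁ i λ j j≢i → agree (suc j) (j≢i ∘ suc-injective)) ⟩
  g zero + (Σℕ (g ∘ suc) + f (suc i)) ≡⟨ +-assoc (g zero) _ _ ⟨
  (g zero + Σℕ (g ∘ suc)) + f (suc i) ∎
  where open ≡-Reasoning

-- Two applications of `Σ-exchange₁`, through the hybrid `h` that takes the value of `g` at `i` and
-- of `f` elsewhere.
Σ-exchange₂ : ∀ {m} {f g : Fin m → ℕ} i j → i ≢ j → (∀ k → k ≢ i → k ≢ j → f k ≡ g k) →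
  Σℕ f + (g i + g j) ≡ Σℕ g + (f i + f j)
Σ-exchange₂ {f = f} {g} i j i≢j agree = begin
  Σℕ f + (g i + g j) ≡⟨ +-assoc _ (g i) (g j) ⟨
  Σℕ f + g i + g j   ≡⟨ cong (λ x → Σℕ f + x + g j) hi ⟨
  Σℕ f + h i + g j   ≡⟨ cong (_+ g j) (Σ-exchange₁ {f = f} {h} i λ k k≢i → sym (updateAt-minimal k i f k≢i)) ⟩
  Σℕ h + f i + g j   ≡⟨ lem _ (f i) (g j) ⟩
  Σℕ h + g j + f i   ≡⟨ cong (_+ f i) (Σ-exchange₁ {f = h} {g} j h≈g) ⟩
  Σℕ g + h j + f i   ≡⟨ cong (λ x → Σℕ g + x + f i) (updateAt-minimal j i f (i≢j ∘ sym)) ⟩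
  Σℕ g + f j + f i   ≡⟨ lem′ _ (f i) (f j) ⟩
  Σℕ g + (f i + f j) ∎
  where
  open ≡-Reasoning
  h : Fin _ → ℕ
  h = updateAt f i (const (g i))
  hi : h i ≡ g i
  hi = updateAt-updates i f
  h≈g : ∀ k → k ≢ j → h k ≡ g k
  h≈g k k≢j with k ≟ i
  ... | yes refl = hi
  ... | no k≢i   = trans (updateAt-minimal k i f k≢i) (agree k k≢i k≢j)
  lem : ∀ a b c → a + b + c ≡ a + c + b
  lem = solve-∀
  lem′ : ∀ a b c → a + c + b ≡ a + (b + c)
  lem′ = solve-∀

-- Sums over a decidable set of indices

restrict : ∀ {m} → (Fin m → Bool) → (Fin m → ℕ) → Fin m → ℕ
restrict P x i = if P i then x i else 0

count : ∀ {m} → (Fin m → Bool) → ℕ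
count P = Σℕ (restrict P (const 1))

argmax : ∀ {m} (P : Fin m → Bool) (x : Fin m → ℕ) → 0 < count P →
  ∃ λ i → P i ≡ true × (∀ j → P j ≡ true → x j ≤ x i)
argmax {suc m} P x pos with P zero in P0 | count (P ∘ suc) in eq
... | false | _ = case argmax (P ∘ suc) (x ∘ suc) (subst (0 <_) (sym eq) pos) of λ
  { (i , Pi , max) → suc i , Pi , λ { zero P0′ → case trans (sym P0) P0′ of λ () ; (suc j) → max j } }
-- No later index satisfies `P`, so `zero` is the only candidate.
... | true  | zero  = zero , P0 , λ { zero _ → ≤-refl ; (suc j) Pj →
  contradiction (≤-trans (≤-reflexive (sym (cong (if_then 1 else 0) Pj))) (≤-trans (≤-Σ _ j) (≤-reflexive eq))) λ () }
... | true  | suc _ = case argmax (P ∘ suc) (x ∘ suc) (subst (0 <_) (sym eq) z<s) of λ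
  { (i , Pi , max) → case x (suc i) ≤? x zero of λ
    { (yes le) → zero , P0 , λ { zero _ → ≤-refl ; (suc j) Pj → ≤-trans (max j Pj) le }
    ; (no nle) → suc i , Pi , λ { zero _ → <⇒≤ (≰⇒> nle) ; (suc j) → max j } } }

-- With M the largest value on `P`, the first sum is at most M · `count P`, while every value on `Q`
-- is at least M + 1 and there are equally many of them.
Σ-separated : ∀ {m} (P Q : Fin m → Bool) (x : Fin m → ℕ) → count P ≡ count Q → 0 < count P →
  (∀ i j → P i ≡ true → Q j ≡ true → x i < x j) → Σℕ (restrict P x) < Σℕ (restrict Q x)
Σ-separated P Q x eq pos lt with argmax P x pos
... | i , Pi , max = begin-strict
  Σℕ (restrict P x)                             ≤⟨ Σ-mono-≤ below ⟩
  Σℕ (λ j → x i * restrict P (const 1) j)       ≡⟨ Σ-*ˡ (x i) (restrict P (const 1)) ⟩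
  x i * count P                                 <⟨ m<n+m (x i * count P) pos ⟩
  suc (x i) * count P                           ≡⟨ cong (suc (x i) *_) eq ⟩
  suc (x i) * count Q                           ≡⟨ Σ-*ˡ (suc (x i)) (restrict Q (const 1)) ⟨
  Σℕ (λ j → suc (x i) * restrict Q (const 1) j) ≤⟨ Σ-mono-≤ above ⟩
  Σℕ (restrict Q x)                             ∎
  where
  open ≤-Reasoning
  below : ∀ j → restrict P x j ≤ x i * restrict P (const 1) j
  below j with P j in Pj
  ... | true  = ≤-trans (max j Pj) (≤-reflexive (sym (*-identityʳ _)))
  ... | false = z≤n
  above : ∀ j → suc (x i) * restrict Q (const 1) j ≤ restrict Q x j
  above j with Q j in Qj
  ... | true  = ≤-trans (≤-reflexive (*-identityʳ _)) (lt i j Pi Qj)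
  ... | false = ≤-reflexive (*-zeroʳ (x i))

-- Inequalities behind the potentials

-- Reads a strict change of the potential off an identity such as `Σ-exchange₂`: the total is
-- balanced, so the larger remainder goes with the smaller sum.
exchange-< : ∀ {a b x y} → a + x ≡ b + y → x < y → b < a
exchange-< eq x<y = ≰⇒> λ a≤b → <-irrefl eq (+-mono-≤-< a≤b x<y)

-- Write `x = s + (d + 1)` and `y = s - (d + 1)`: the sum of squares exceeds `2s²` by `2(d + 1)²`.
squares-spread-> : ∀ {s x y} → s < x → x + y ≡ s + s → s * s + s * s < x * x + y * y
squares-spread-> {s} {x} {y} s<x eq with m≤n⇒∃[o]m+o≡n s<x
... | d , refl with +-cancelˡ-≡ s _ _ (trans (sym (shift s d y)) eq)
  where
  shift : ∀ s d y → suc s + d + y ≡ s + (suc d + y)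
  shift = solve-∀
... | refl = <-≤-trans (m<m+n _ z<s) (≤-reflexive (expand d y))
  where
  expand : ∀ d y → (suc d + y) * (suc d + y) + (suc d + y) * (suc d + y) + (suc d * suc d + suc d * suc d) ≡
    (suc (suc d + y) + d) * (suc (suc d + y) + d) + y * y
  expand = solve-∀

squares-spread : ∀ {s x y} → x + y ≡ s + s → x ≢ s → s * s + s * s < x * x + y * y
squares-spread {s} {x} {y} eq x≢s with <-cmp x s
... | tri> _ _ s<x = squares-spread-> s<x eq
... | tri≈ _ x≡s _ = contradiction x≡s x≢s
... | tri< x<s _ _ = subst (s * s + s * s <_) (+-comm (y * y) _)
  (squares-spread-> (≰⇒> λ y≤s → <-irrefl eq (+-mono-<-≤ x<s y≤s)) (trans (+-comm y x) eq))

-- The rearrangement inequality; the gap is `(b - a)(y - x)`.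
exchange-products : ∀ {a b x y} → a < b → x < y → a * y + b * x < a * x + b * y
exchange-products {a} {b} {x} {y} a<b x<y with m≤n⇒∃[o]m+o≡n a<b | m≤n⇒∃[o]m+o≡n x<y
... | p , refl | q , refl = <-≤-trans (m<m+n _ z<s) (≤-reflexive (expand a p x q))
  where
  expand : ∀ a p x q → a * (suc x + q) + (suc a + p) * x + suc p * suc q ≡ a * x + (suc a + p) * (suc x + q)
  expand = solve-∀

-- Values of a transposition

transpose-ˡ : ∀ {n} (i j : Fin n) → transpose i j ⟨$⟩ʳ i ≡ j
transpose-ˡ i j rewrite dec-true (i ≟ i) refl = refl

transpose-ʳ : ∀ {n} (i j : Fin n) → transpose i j ⟨$⟩ʳ j ≡ i
transpose-ʳ i j with j ≟ i
... | yes j≡i = j≡i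
... | no  _ rewrite dec-true (j ≟ j) refl = refl

transpose-minimal : ∀ {n} (i j : Fin n) {k} → k ≢ i → k ≢ j → transpose i j ⟨$⟩ʳ k ≡ k
transpose-minimal i j {k} k≢i k≢j rewrite dec-false (k ≟ i) k≢i | dec-false (k ≟ j) k≢j = refl

-- Parity and layerings by depth

odd : ℕ → Bool
odd zero    = false
odd (suc k) = not (odd k)

odd-gap : ∀ {i j} → odd i ≡ odd j → i < j → 2 + i ≤ j
odd-gap {i} {j} eq i<j with m≤n⇒m<n∨m≡n i<j
... | inj₁ gap  = gap
... | inj₂ refl = contradiction eq (Bool.not-¬ refl)

Consecutive : ℕ → ℕ → Set
Consecutive i j = i ≡ suc j ⊎ j ≡ suc i

-- The ends of e in X and in Y are end true e and end false e.
module Bipartite {n m : ℕ} (side : Fin n → Bool) (end : Bool → Fin m → Fin n)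
  (side-end : ∀ β e → side (end β e) ≡ β) where

  side≡ : ∀ {β e v} → end β e ≡ v → side v ≡ β
  side≡ {β} {e} refl = side-end β e

  -- The parent is recorded as an edge, because labels of edges are what the swaps exchange.
  Parent : (Fin n → ℕ) → Fin n → Fin m → Set
  Parent d v e = end (side v) e ≡ v × d v ≡ suc (d (end (not (side v)) e))

  record Layering : Set where
    field
      depth       : Fin n → ℕ
      consecutive : ∀ e → Consecutive (depth (end true e)) (depth (end false e))
      odd-depth   : ∀ v → odd (depth v) ≡ side v
      -- No even or odd layer is skipped, which bounds the depths (by pigeonhole).
      chain       : ∀ v → 2 ≤ depth v → ∃ λ w → 2 + depth w ≡ depth v

    consecutive′ : ∀ β e → Consecutive (depth (end β e)) (depth (end (not β) e))
    consecutive′ true  e = consecutive e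
    consecutive′ false e = Sum.swap (consecutive e)

    descend : ∀ k v → k * 2 ≤ depth v → ∃ λ w → k * 2 + depth w ≡ depth v
    descend zero    v _  = v , refl
    descend (suc k) v le with chain v (≤-trans (m≤m+n 2 _) le)
    ... | w , eq with descend k w (+-cancelˡ-≤ 2 _ _ (≤-trans le (≤-reflexive (sym eq))))
    ... | u , eq′ = u , trans (cong (2 +_) eq′) eq

    -- From depth `2n` or more, descending by 0, 2, ..., `2n` would reach `n + 1` vertices of
    -- pairwise different depths.
    depth-bounded : ∀ v → depth v ≤ n * 2
    depth-bounded v with ≤-total (depth v) (n * 2)
    ... | inj₁ le = le
    ... | inj₂ ge = contradiction (injective⇒≤ {f = f} f-injective) (<⇒≱ ≤-refl)
      where
      le : ∀ (k : Fin (suc n)) → toℕ k * 2 ≤ depth v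
      le k = ≤-trans (*-monoˡ-≤ 2 (s≤s⁻¹ (toℕ<n k))) ge
      f : Fin (suc n) → Fin n
      f k = proj₁ (descend (toℕ k) v (le k))
      f-injective : ∀ {j k} → f j ≡ f k → j ≡ k
      f-injective {j} {k} eq = toℕ-injective (*-cancelʳ-≡ _ _ 2 (+-cancelʳ-≡ (depth (f j)) _ _ (begin
        toℕ j * 2 + depth (f j) ≡⟨ proj₂ (descend (toℕ j) v (le j)) ⟩
        depth v                 ≡⟨ proj₂ (descend (toℕ k) v (le k)) ⟨
        toℕ k * 2 + depth (f k) ≡⟨ cong (λ w → toℕ k * 2 + depth w) eq ⟨
        toℕ k * 2 + depth (f j) ∎)))
        where open ≡-Reasoning

  open Layering

  Rooted : Layering → Set
  Rooted D = ∀ v w → w ≢ v → depth D w ≡ depth D v → ∃ (Parent (depth D) v)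

  -- The starting point of the search; `chain` is vacuous because no depth reaches 2.
  two-layers : Layering
  two-layers = record
    { depth       = λ v → bit (side v)
    ; consecutive = λ e → inj₁ (trans (cong bit (side-end true e)) (cong (suc ∘ bit) (sym (side-end false e))))
    ; odd-depth   = λ v → odd-bit (side v)
    ; chain       = λ v 2≤ → contradiction (≤-trans 2≤ (bit≤1 (side v))) λ { (s≤s ()) }
    }
    where
    bit : Bool → ℕ
    bit β = if β then 1 else 0
    odd-bit : ∀ β → odd (bit β) ≡ β
    odd-bit true  = refl
    odd-bit false = refl
    bit≤1 : ∀ β → bit β ≤ 1
    bit≤1 true  = ≤-refl
    bit≤1 false = z≤n

  -- Raising the depth of a parentless vertex by 2 makes its neighbours its parents, and its
  -- old layer stays occupied by w, so the chain property survives; the depths being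
  -- bounded, this terminates.
  module Raise (D : Layering) (v w : Fin n) (w≢v : w ≢ v) (d[w]≡d[v] : depth D w ≡ depth D v)
    (orphan : ¬ ∃ (Parent (depth D) v)) where

    d′ : Fin n → ℕ
    d′ = updateAt (depth D) v (2 +_)

    raised : d′ v ≡ 2 + depth D v
    raised = updateAt-updates v (depth D)

    kept : ∀ {u} → u ≢ v → d′ u ≡ depth D u
    kept {u} = updateAt-minimal u v (depth D)

    -- Without a parent, `v` has all its neighbours one level deeper; adding 2 to its depth places
    -- it one level below each of them.
    above : ∀ β e → end β e ≡ v → d′ (end β e) ≡ suc (d′ (end (not β) e))
    above β e p with side≡ p | consecutive′ D β e
    ... | refl | inj₁ down = contradiction (e , p , trans (cong (depth D) (sym p)) down) orphan
    ... | refl | inj₂ up   = begin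
      d′ (end β e)                  ≡⟨ cong d′ p ⟩
      d′ v                          ≡⟨ raised ⟩
      2 + depth D v                 ≡⟨ cong (λ u → 2 + depth D u) p ⟨
      2 + depth D (end β e)         ≡⟨ cong suc up ⟨
      suc (depth D (end (not β) e)) ≡⟨ cong suc (kept (Bool.not-¬ refl ∘ side≡)) ⟨
      suc (d′ (end (not β) e))      ∎
      where open ≡-Reasoning

    raise : Layering
    raise = record
      { depth = d′ ; consecutive = consecutive″ ; odd-depth = odd-depth″ ; chain = chain″ }
      where
      consecutive″ : ∀ e → Consecutive (d′ (end true e)) (d′ (end false e))
      consecutive″ e with end true e ≟ v | end false e ≟ v
      ... | yes p | _     = inj₁ (above true e p)
      ... | no  _ | yes q = inj₂ (above false e q)
      ... | no ¬p | no ¬q = subst₂ Consecutive (sym (kept ¬p)) (sym (kept ¬q)) (consecutive D e)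

      odd-depth″ : ∀ u → odd (d′ u) ≡ side u
      odd-depth″ u with u ≟ v
      ... | yes refl = trans (cong odd raised) (trans (Bool.not-involutive _) (odd-depth D u))
      ... | no u≢v   = trans (cong odd (kept u≢v)) (odd-depth D u)

      -- `w` takes the place of `v` in the layer that `v` has left.
      unraise : ∀ u → ∃ λ u′ → d′ u′ ≡ depth D u
      unraise u with u ≟ v
      ... | yes refl = w , trans (kept w≢v) d[w]≡d[v]
      ... | no u≢v   = u , kept u≢v

      chain″ : ∀ u → 2 ≤ d′ u → ∃ λ u′ → 2 + d′ u′ ≡ d′ u
      chain″ u le with u ≟ v
      ... | yes refl = w , trans (cong (2 +_) (trans (kept w≢v) d[w]≡d[v])) (sym raised)
      ... | no u≢v with chain D u (subst (2 ≤_) (kept u≢v) le)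
      ... | x , eq with unraise x
      ... | x′ , eq′ = x′ , trans (cong (2 +_) eq′) (trans eq (sym (kept u≢v)))

    raise-increases : Σℕ (depth D) < Σℕ d′
    raise-increases = +-cancelʳ-< (depth D v) _ _ (begin-strict
      Σℕ (depth D) + depth D v <⟨ +-monoʳ-< (Σℕ (depth D)) (m<n+m _ {2} z<s) ⟩
      Σℕ (depth D) + (2 + depth D v) ≡⟨ cong (Σℕ (depth D) +_) raised ⟨
      Σℕ (depth D) + d′ v ≡⟨ Σ-exchange₁ v (λ u u≢v → sym (kept u≢v)) ⟩
      Σℕ d′ + depth D v ∎)
      where open ≤-Reasoning

  rooted : ∃ Rooted
  rooted = ascent (Σℕ ∘ depth) (n * (n * 2)) (λ D → Σ-bounded _ (depth-bounded D)) step two-layers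
    where
    step : ∀ D → Rooted D ⊎ ∃ λ D′ → Σℕ (depth D) < Σℕ (depth D′)
    step D = case any? (λ v → any? (λ w → crowded? v w ×-dec ¬? (parent? v))) of λ
      { (yes (v , w , (w≢v , eq) , orphan)) →
          let open Raise D v w w≢v eq orphan in inj₂ (raise , raise-increases)
      ; (no none) → inj₁ λ v w w≢v eq → decidable-stable (parent? v) λ orphan → none (v , w , (w≢v , eq) , orphan) }
      where
      parent? : ∀ v → Dec (∃ (Parent (depth D) v))
      parent? v = any? λ e → (end (side v) e ≟ v) ×-dec (depth D v ℕ.≟ suc (depth D (end (not (side v)) e)))
      crowded? : ∀ v w → Dec (w ≢ v × depth D w ≡ depth D v)
      crowded? v w = ¬? (w ≟ v) ×-dec (depth D w ℕ.≟ depth D v)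

  -- Labels and unsigned vertex totals

  -- A vertex can only be the end of an edge on its own side, so testing that end finds all edges at
  -- `v`.
  at : Fin n → Fin m → Bool
  at v e = does (end (side v) e ≟ v)

  label : Permutation′ m → Fin m → ℕ
  label L e = suc (toℕ (L ⟨$⟩ʳ e))

  -- The absolute value of the oriented vertex sum once all edges run from X to Y.
  total : Permutation′ m → Fin n → ℕ
  total L v = Σℕ (restrict (at v) (label L))

  label-injective : ∀ L {e f} → label L e ≡ label L f → e ≡ f
  label-injective L {e} {f} eq = begin
    e                        ≡⟨ inverseˡ L ⟨
    L ⟨$⟩ˡ (L ⟨$⟩ʳ e)        ≡⟨ cong (L ⟨$⟩ˡ_) (toℕ-injective (ℕ.suc-injective eq)) ⟩
    L ⟨$⟩ˡ (L ⟨$⟩ʳ f)        ≡⟨ inverseˡ L ⟩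
    f                        ∎
    where open ≡-Reasoning

  restrict-at : ∀ {v e} (x : Fin m → ℕ) → end (side v) e ≡ v → restrict (at v) x e ≡ x e
  restrict-at {v} {e} x p = cong (if_then x e else 0) (dec-true (end (side v) e ≟ v) p)

  total-bounded : ∀ L v → total L v ≤ m * m
  total-bounded L v = Σ-bounded m bound
    where
    bound : ∀ e → restrict (at v) (label L) e ≤ m
    bound e with at v e
    ... | true  = toℕ<n (L ⟨$⟩ʳ e)
    ... | false = z≤n

  total-positive : ∀ L v → 0 < count (at v) → 0 < total L v
  total-positive L v pos = ≤-trans pos (Σ-mono-≤ bound)
    where
    bound : ∀ e → restrict (at v) (const 1) e ≤ restrict (at v) (label L) e
    bound e with at v e
    ... | true  = s≤s z≤n
    ... | false = z≤n

  total-unchanged : ∀ L τ v → (∀ e → end (side v) e ≡ v → τ ⟨$⟩ʳ e ≡ e) →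
    total (τ ∘ₚ L) v ≡ total L v
  total-unchanged L τ v fixed = Σ-cong eq
    where
    eq : ∀ e → restrict (at v) (label (τ ∘ₚ L)) e ≡ restrict (at v) (label L) e
    eq e with end (side v) e ≟ v
    ... | yes p = cong (label L) (fixed e p)
    ... | no  _ = refl

  total-relabel : ∀ L τ v e → end (side v) e ≡ v →
    (∀ f → f ≢ e → end (side v) f ≡ v → τ ⟨$⟩ʳ f ≡ f) →
    total (τ ∘ₚ L) v + label L e ≡ total L v + label L (τ ⟨$⟩ʳ e)
  total-relabel L τ v e p fixed = begin
    total (τ ∘ₚ L) v + label L e                                ≡⟨ cong (total (τ ∘ₚ L) v +_) (restrict-at (label L) p) ⟨
    total (τ ∘ₚ L) v + restrict (at v) (label L) e              ≡⟨ Σ-exchange₁ e eq ⟩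
    total L v + restrict (at v) (label (τ ∘ₚ L)) e              ≡⟨ cong (total L v +_) (restrict-at (label (τ ∘ₚ L)) p) ⟩
    total L v + label L (τ ⟨$⟩ʳ e)                              ∎
    where
    open ≡-Reasoning
    eq : ∀ f → f ≢ e → restrict (at v) (label (τ ∘ₚ L)) f ≡ restrict (at v) (label L) f
    eq f f≢e with end (side v) f ≟ v
    ... | yes q = cong (label L) (fixed f f≢e q)
    ... | no  _ = refl

  -- Labelings sorted by edge depth

  module Labelling (D : Layering) (D-rooted : Rooted D) where

    d : Fin n → ℕ
    d = depth D

    -- Adjacent depths are consecutive, so this is `2j + 1` with `j` the smaller depth: it ranks
    -- edges by how deep they lie.
    height : Fin m → ℕ
    height e = d (end true e) + d (end false e)

    height-split : ∀ β e → height e ≡ d (end β e) + d (end (not β) e)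
    height-split true  e = refl
    height-split false e = +-comm (d (end true e)) _

    height-parent : ∀ {v e} → Parent d v e → suc (height e) ≡ d v + d v
    height-parent {v} {e} (p , q) = begin
      suc (height e)                                        ≡⟨ cong suc (height-split (side v) e) ⟩
      suc (d (end (side v) e) + d (end (not (side v)) e))   ≡⟨ +-suc _ _ ⟨
      d (end (side v) e) + suc (d (end (not (side v)) e))   ≡⟨ cong₂ _+_ (cong d p) (sym q) ⟩
      d v + d v                                             ∎
      where open ≡-Reasoning

    -- The other end has depth `d v ± 1`, so the height is `2 d v ± 1`.
    height-near : ∀ {v e} → end (side v) e ≡ v → height e ≤ suc (d v + d v) × d v + d v ≤ suc (height e)
    height-near {v} {e} p rewrite height-split (side v) e with consecutive′ D (side v) e
    ... | inj₁ down rewrite p = ≤-trans (+-monoʳ-≤ (d v) (≤-trans (n≤1+n _) (≤-reflexive (sym down)))) (n≤1+n _)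
                              , ≤-reflexive (trans (cong (d v +_) down) (+-suc (d v) _))
    ... | inj₂ up   rewrite p = ≤-reflexive (trans (cong (d v +_) up) (+-suc (d v) _))
                              , ≤-trans (+-monoʳ-≤ (d v) (≤-trans (n≤1+n _) (≤-reflexive (sym up)))) (n≤1+n _)

    Sorted : Permutation′ m → Set
    Sorted L = ∀ e f → height e < height f → label L f < label L e

    -- Minimises the sum of height times label: by the rearrangement inequality, exchanging the
    -- labels of a pair in the wrong order lowers this cost.
    sorted : ∃ Sorted
    sorted = descent cost step Perm.id
      where
      cost : Permutation′ m → ℕ
      cost L = Σℕ (λ e → height e * label L e)
      step : ∀ L → Sorted L ⊎ ∃ λ L′ → cost L′ < cost L
      step L = case any? (λ e → any? (λ f → (height e <? height f) ×-dec (label L e <? label L f))) of λ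
        { (no none) → inj₁ λ e f h< → ≤∧≢⇒< (≮⇒≥ λ l< → none (e , f , h< , l<)) λ eq →
            <-irrefl (cong height (label-injective L (sym eq))) h<
        ; (yes (e , f , h< , l<)) → inj₂ (transpose e f ∘ₚ L , improve e f h< l<) }
        where
        improve : ∀ e f → height e < height f → label L e < label L f → cost (transpose e f ∘ₚ L) < cost L
        improve e f h< l< = exchange-<
          (Σ-exchange₂ e f (λ e≡f → <-irrefl (cong height e≡f) h<)
            λ g g≢e g≢f → cong (λ x → height g * label L x) (sym (transpose-minimal e f g≢e g≢f)))
          (subst₂ (λ x y → height e * label L x + height f * label L y < height e * label L e + height f * label L f)
            (sym (transpose-ˡ e f)) (sym (transpose-ʳ e f)) (exchange-products h< l<))

    -- Removing ties within a layer

    Separated : ℕ → Permutation′ m → Set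
    Separated k L = ∀ v w → k ≤ d v → d v ≡ d w → total L v ≡ total L w → v ≡ w

    State : ℕ → Permutation′ m → Set
    State k L = Sorted L × Separated k L

    -- The other end of a parent edge of `v` is less deep than `v`. Hence relabeling such an edge
    -- affects, among vertices at least as deep as `v`, only `v` itself.
    parent-unique : ∀ {v e u} → Parent d v e → end (side u) e ≡ u → d v ≤ d u → u ≡ v
    parent-unique {v} {e} {u} (p , q) r le with side u Bool.≟ side v
    ... | yes eq = trans (sym r) (trans (cong (λ β → end β e) eq) p)
    ... | no neq = contradiction le (<⇒≱ (≤-reflexive (trans (cong (suc ∘ d) u≡other) (sym q))))
      where
      u≡other : u ≡ end (not (side v)) e
      u≡other = trans (sym r) (cong (λ β → end β e) (Bool.¬-not neq))

    module Swap (k : ℕ) (L : Permutation′ m) (L-state : State (suc k) L)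
      (v w : Fin n) (v≢w : v ≢ w) (dv : d v ≡ k) (dw : d w ≡ k) (tie : total L v ≡ total L w)
      (e f : Fin m) (v-e : Parent d v e) (w-f : Parent d w f) where

      L′ : Permutation′ m
      L′ = transpose e f ∘ₚ L

      not-e : ∀ {u} → u ≢ v → k ≤ d u → end (side u) e ≢ u
      not-e u≢v le r = u≢v (parent-unique v-e r (subst (_≤ _) (sym dv) le))

      not-f : ∀ {u} → u ≢ w → k ≤ d u → end (side u) f ≢ u
      not-f u≢w le r = u≢w (parent-unique w-f r (subst (_≤ _) (sym dw) le))

      -- Both are parent edges from depth `k`, of height `2k - 1`; thus exchanging their labels
      -- keeps the labeling sorted.
      height-e≡f : height e ≡ height f
      height-e≡f = ℕ.suc-injective (trans (height-parent v-e)
        (trans (cong₂ _+_ (trans dv (sym dw)) (trans dv (sym dw))) (sym (height-parent w-f))))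

      height-swap : ∀ g → height (transpose e f ⟨$⟩ʳ g) ≡ height g
      height-swap g = by-cases (g ≟ e) (g ≟ f)
        where
        by-cases : Dec (g ≡ e) → Dec (g ≡ f) → height (transpose e f ⟨$⟩ʳ g) ≡ height g
        by-cases (yes refl) _          = trans (cong height (transpose-ˡ e f)) (sym height-e≡f)
        by-cases (no _)     (yes refl) = trans (cong height (transpose-ʳ e f)) height-e≡f
        by-cases (no g≢e)   (no g≢f)   = cong height (transpose-minimal e f g≢e g≢f)

      unchanged : ∀ u → u ≢ v → u ≢ w → k ≤ d u → total L′ u ≡ total L u
      unchanged u u≢v u≢w le = total-unchanged L (transpose e f) u λ g r →
        transpose-minimal e f (λ { refl → not-e u≢v le r }) (λ { refl → not-f u≢w le r })

      total-v : total L′ v + label L e ≡ total L v + label L f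
      total-v = trans
        (total-relabel L (transpose e f) v e (proj₁ v-e) λ g g≢e r →
          transpose-minimal e f g≢e λ { refl → not-f v≢w (≤-reflexive (sym dv)) r })
        (cong (λ g → total L v + label L g) (transpose-ˡ e f))

      total-w : total L′ w + label L f ≡ total L w + label L e
      total-w = trans
        (total-relabel L (transpose e f) w f (proj₁ w-f) λ g g≢f r →
          transpose-minimal e f (λ { refl → not-e (v≢w ∘ sym) (≤-reflexive (sym dw)) r }) g≢f)
        (cong (λ g → total L w + label L g) (transpose-ʳ e f))

      L′-state : State (suc k) L′
      L′-state = sorted′ , separated′
        where
        sorted′ : Sorted L′
        sorted′ g h lt = proj₁ L-state _ _ (subst₂ _<_ (sym (height-swap g)) (sym (height-swap h)) lt)
        unchanged′ : ∀ u → k < d u → total L′ u ≡ total L u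
        unchanged′ u lt = unchanged u (λ { refl → <-irrefl (sym dv) lt }) (λ { refl → <-irrefl (sym dw) lt }) (<⇒≤ lt)
        separated′ : Separated (suc k) L′
        separated′ u x lt du≡dx eq = proj₂ L-state u x lt du≡dx
          (trans (sym (unchanged′ u lt)) (trans eq (unchanged′ x (subst (k <_) du≡dx lt))))

      -- `v` gains what `w` loses. Together with `moved` this supplies the hypotheses of
      -- `squares-spread`.
      balanced : total L′ v + total L′ w ≡ total L v + total L v
      balanced = +-cancelʳ-≡ (label L e + label L f) _ _ (begin
        (total L′ v + total L′ w) + (label L e + label L f) ≡⟨ interchange (total L′ v) _ _ _ ⟩
        (total L′ v + label L e) + (total L′ w + label L f) ≡⟨ cong₂ _+_ total-v (trans total-w (cong (_+ label L e) (sym tie))) ⟩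
        (total L v + label L f) + (total L v + label L e)   ≡⟨ interchange (total L v) _ _ _ ⟨
        (total L v + total L v) + (label L f + label L e)   ≡⟨ cong (total L v + total L v +_) (+-comm (label L f) _) ⟩
        (total L v + total L v) + (label L e + label L f)   ∎)
        where
        open ≡-Reasoning
        interchange : ∀ a b c d → (a + b) + (c + d) ≡ (a + c) + (b + d)
        interchange = solve-∀

      -- An unchanged total would force equal labels, hence `e ≡ f`; but `f` does not meet `v`.
      moved : total L′ v ≢ total L v
      moved eq = not-f v≢w (≤-reflexive (sym dv)) (subst (λ g → end (side v) g ≡ v) e≡f (proj₁ v-e))
        where
        e≡f : e ≡ f
        e≡f = label-injective L (+-cancelˡ-≡ (total L v) _ _ (trans (cong (_+ label L e) (sym eq)) total-v))

    onLayer : ℕ → Fin n → Bool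
    onLayer k v = does (d v ℕ.≟ k)

    energy : ℕ → Permutation′ m → ℕ
    energy k L = Σℕ (restrict (onLayer k) (λ v → total L v * total L v))

    energy-bounded : ∀ k L → energy k L ≤ n * (m * m * (m * m))
    energy-bounded k L = Σ-bounded _ bound
      where
      bound : ∀ v → restrict (onLayer k) (λ v → total L v * total L v) v ≤ m * m * (m * m)
      bound v with onLayer k v
      ... | true  = *-mono-≤ (total-bounded L v) (total-bounded L v)
      ... | false = z≤n

    refine : ∀ k → ∃ (State (suc k)) → ∃ (State k)
    refine k L₀ with ascent {Good = State k ∘ proj₁} (energy k ∘ proj₁) _ (energy-bounded k ∘ proj₁) step L₀
      where
      step : ∀ (L : ∃ (State (suc k))) → State k (proj₁ L) ⊎ ∃ λ (L′ : ∃ (State (suc k))) → energy k (proj₁ L) < energy k (proj₁ L′)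
      step (L , L-state) = case any? (λ v → any? (λ w → tie? v w)) of λ
        { (yes (v , w , v≢w , dv , dw , tie)) →
            -- Tied vertices share depth `k`, so each one witnesses that the other is not alone
            -- there, and both have parent edges.
            case D-rooted v w (v≢w ∘ sym) (trans dw (sym dv)) , D-rooted w v v≢w (trans dv (sym dw)) of λ
              { ((e , v-e) , (f , w-f)) → improve v w v≢w dv dw tie e f v-e w-f }
        ; (no none) → inj₁ (proj₁ L-state , λ v w k≤dv dv≡dw tie → case m≤n⇒m<n∨m≡n k≤dv of λ
            { (inj₁ k<dv) → proj₂ L-state v w k<dv dv≡dw tie
            ; (inj₂ k≡dv) → decidable-stable (v ≟ w) λ v≢w →
                none (v , w , v≢w , sym k≡dv , trans (sym dv≡dw) (sym k≡dv) , tie) }) }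
        where
        tie? : ∀ v w → Dec (v ≢ w × d v ≡ k × d w ≡ k × total L v ≡ total L w)
        tie? v w = ¬? (v ≟ w) ×-dec (d v ℕ.≟ k) ×-dec (d w ℕ.≟ k) ×-dec (total L v ℕ.≟ total L w)
        improve : ∀ v w → v ≢ w → d v ≡ k → d w ≡ k → total L v ≡ total L w →
          ∀ e f → Parent d v e → Parent d w f →
          State k L ⊎ ∃ λ (L′ : ∃ (State (suc k))) → energy k L < energy k (proj₁ L′)
        -- Within layer `k` only the squares of `v` and `w` change, so the growth of their sum is
        -- the growth of the energy.
        improve v w v≢w dv dw tie e f v-e w-f = inj₂ ((L′ , L′-state) , exchange-< (sym (Σ-exchange₂ v w v≢w agree)) grows)
          where
          open Swap k L L-state v w v≢w dv dw tie e f v-e w-f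
          q : Permutation′ m → Fin n → ℕ
          q K u = total K u * total K u
          on : ∀ {u} K → d u ≡ k → restrict (onLayer k) (q K) u ≡ q K u
          on {u} K du = cong (if_then q K u else 0) (dec-true (d u ℕ.≟ k) du)
          off : ∀ {u} K → d u ≢ k → restrict (onLayer k) (q K) u ≡ 0
          off {u} K du = cong (if_then q K u else 0) (dec-false (d u ℕ.≟ k) du)
          agree : ∀ u → u ≢ v → u ≢ w → restrict (onLayer k) (q L) u ≡ restrict (onLayer k) (q L′) u
          agree u u≢v u≢w = case d u ℕ.≟ k of λ
            { (yes du) → trans (on L du) (trans (cong (λ t → t * t) (sym (unchanged u u≢v u≢w (≤-reflexive (sym du))))) (sym (on L′ du)))
            ; (no du)  → trans (off L du) (sym (off L′ du)) }
          grows : restrict (onLayer k) (q L) v + restrict (onLayer k) (q L) w <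
                  restrict (onLayer k) (q L′) v + restrict (onLayer k) (q L′) w
          grows = subst₂ _<_
            (sym (cong₂ _+_ (on L dv) (trans (on L dw) (cong (λ t → t * t) (sym tie)))))
            (sym (cong₂ _+_ (on L′ dv) (on L′ dw)))
            (squares-spread balanced moved)
    ... | (L , _) , good = L , good

    separated : ∃ (State 0)
    -- No vertex is deeper than `2n`, so at this threshold separation holds vacuously.
    separated = lower (suc (n * 2)) (L , L-sorted , λ v w lt → contradiction (depth-bounded D v) (<⇒≱ lt))
      where
      L = proj₁ sorted
      L-sorted = proj₂ sorted
      lower : ∀ k → ∃ (State k) → ∃ (State 0)
      lower zero    s = s
      lower (suc k) s = lower k (refine k s)

    -- Comparing totals on one side

    -- Equal parity makes the depths differ by at least 2, so heights at `v` are at most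
    -- `2 d v + 1`, below the least possible height `2 d w - 1` at `w`. Sortedness and `Σ-separated`
    -- then apply.
    total-decreasing : ∀ L → Sorted L → ∀ v w → side v ≡ side w → count (at v) ≡ count (at w) → 0 < count (at v) →
      d v < d w → total L w < total L v
    total-decreasing L L-sorted v w sv≡sw cv≡cw pos dv<dw =
      Σ-separated (at w) (at v) (label L) (sym cv≡cw) (subst (0 <_) cv≡cw pos) λ e f w-e v-f →
        L-sorted f e (s≤s⁻¹ (begin-strict
          suc (height f)            ≤⟨ s≤s (proj₁ (height-near (at⇒ v-f))) ⟩
          2 + (d v + d v)           <⟨ n<1+n _ ⟩
          3 + (d v + d v)           <⟨ n<1+n _ ⟩
          4 + (d v + d v)           ≡⟨ shift (d v) ⟩
          (2 + d v) + (2 + d v)     ≤⟨ +-mono-≤ gap gap ⟩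
          d w + d w                 ≤⟨ proj₂ (height-near (at⇒ w-e)) ⟩
          suc (height e)            ∎))
      where
      open ≤-Reasoning
      gap : 2 + d v ≤ d w
      gap = odd-gap (trans (odd-depth D v) (trans sv≡sw (sym (odd-depth D w)))) dv<dw
      shift : ∀ x → 4 + (x + x) ≡ (2 + x) + (2 + x)
      shift = solve-∀
      at⇒ : ∀ {u g} → at u g ≡ true → end (side u) g ≡ u
      at⇒ {u} {g} eq with end (side u) g ≟ u
      ... | yes p = p

  distinct-totals : (∀ v w → side v ≡ side w → count (at v) ≡ count (at w)) → (∀ v → 0 < count (at v)) →
    ∃ λ L → ∀ v w → side v ≡ side w → total L v ≡ total L w → v ≡ w
  distinct-totals regular pos with rooted
  ... | D , D-rooted with Labelling.separated D D-rooted
  ... | L , L-sorted , L-separated = L , λ v w sv≡sw eq → case <-cmp (depth D v) (depth D w) of λ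
    { (tri< lt _ _) → contradiction (sym eq) (<⇒≢ (decreasing v w sv≡sw (regular v w sv≡sw) (pos v) lt))
    ; (tri≈ _ dv≡dw _) → L-separated v w z≤n dv≡dw eq
    ; (tri> _ _ gt) → contradiction eq (<⇒≢ (decreasing w v (sym sv≡sw) (regular w v (sym sv≡sw)) (pos w) gt)) }
    where
    decreasing = Labelling.total-decreasing D D-rooted L L-sorted

-- From totals to oriented vertex sums

Σℤ-+ : ∀ {m} {f : Fin m → ℤ.ℤ} {g : Fin m → ℕ} → (∀ i → f i ≡ ℤ.+ g i) → Σℤ f ≡ ℤ.+ Σℕ g
Σℤ-+ {zero}  eq = refl
Σℤ-+ {suc m} eq = cong₂ ℤ._+_ (eq zero) (Σℤ-+ (eq ∘ suc))

Σℤ-neg : ∀ {m} {f : Fin m → ℤ.ℤ} {g : Fin m → ℕ} → (∀ i → f i ≡ ℤ.- ℤ.+ g i) → Σℤ f ≡ ℤ.- ℤ.+ Σℕ g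
Σℤ-neg {zero}          eq = refl
Σℤ-neg {suc m} {g = g} eq = trans (cong₂ ℤ._+_ (eq zero) (Σℤ-neg (eq ∘ suc)))
  (sym (ℤ.neg-distrib-+ (ℤ.+ g zero) (ℤ.+ Σℕ (g ∘ suc))))

-- Positivity excludes the coincidence of -0 and +0; this tells vertices of X from vertices of Y.
-a≢b : ∀ {a b} → 0 < a → ℤ.- ℤ.+ a ≢ ℤ.+ b
-a≢b (s≤s _) ()

module FromXToY {n m} (G : Graph n m) (side : Fin n → Bool) (bipartition : IsBipartition G side) where

  -- `true` directs an edge from its first to its second end, so every tail lies in X.
  orientation : Orientation m
  orientation e = side (proj₁ (ends G e))

  end : Bool → Fin m → Fin n
  end β e = if β then tail G orientation e else head G orientation e

  side-end : ∀ β e → side (end β e) ≡ β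
  side-end β e = go β (proj₁ (ends G e)) (proj₂ (ends G e)) (bipartition e)
    where
    go : ∀ β p q → side p ≢ side q → side (if β then (if side p then p else q) else (if side p then q else p)) ≡ β
    go true p q p≢q with side p in sp
    ... | true  = sp
    ... | false = Bool.¬-not (p≢q ∘ sym)
    go false p q p≢q with side p in sp
    ... | true  = Bool.¬-not (p≢q ∘ sym)
    ... | false = sp

  open Bipartite side end side-end

  -- `degree` tests both ends of an edge and `at v` only the one on the side of `v`; the other end
  -- is never `v`.
  count-at : ∀ v → count (at v) ≡ degree G v
  count-at v = Σ-cong λ e → go v (proj₁ (ends G e)) (proj₂ (ends G e)) (bipartition e)
    where
    go : ∀ v p q → side p ≢ side q →
      (if does ((if side v then (if side p then p else q) else (if side p then q else p)) ≟ v) then 1 else 0) ≡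
      (if ⌊ p ≟ v ⌋ then 1 else 0) + (if ⌊ q ≟ v ⌋ then 1 else 0)
    go v p q p≢q with side v in sv | side p in sp
    go v p q p≢q | true | true with p ≟ v | q ≟ v
    ... | _     | yes refl = contradiction (sym sv) p≢q
    ... | yes _ | no _     = refl
    ... | no _  | no _     = refl
    go v p q p≢q | true | false with p ≟ v | q ≟ v
    ... | yes refl | _     = contradiction (trans (sym sp) sv) λ ()
    ... | no _     | yes _ = refl
    ... | no _     | no _  = refl
    go v p q p≢q | false | true with p ≟ v | q ≟ v
    ... | yes refl | _     = contradiction (trans (sym sp) sv) λ ()
    ... | no _     | yes _ = refl
    ... | no _     | no _  = refl
    go v p q p≢q | false | false with p ≟ v | q ≟ v
    ... | _     | yes refl = contradiction (sym sv) p≢q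
    ... | yes _ | no _     = refl
    ... | no _  | no _     = refl

  -- One of the two terms in a summand of `vertexSum`: entering for `β = false`, leaving for
  -- `β = true`.
  arrow : (Fin m → ℕ) → Fin n → Bool → Fin m → ℤ.ℤ
  arrow x v β e = if ⌊ end β e ≟ v ⌋ then ℤ.+ x e else ℤ.+ 0

  arrow-own : ∀ x {v β} → side v ≡ β → ∀ e → arrow x v β e ≡ ℤ.+ restrict (at v) x e
  arrow-own x {v} refl e with end (side v) e ≟ v
  ... | yes _ = refl
  ... | no  _ = refl

  arrow-other : ∀ x {v β} → side v ≢ β → ∀ e → arrow x v β e ≡ ℤ.+ 0
  arrow-other x {v} {β} sv≢β e with end β e ≟ v
  ... | yes p = contradiction (side≡ p) sv≢β
  ... | no  _ = refl

  vertexSum-Y : ∀ L {v} → side v ≡ false → vertexSum G orientation (L ⟨$⟩ʳ_) v ≡ ℤ.+ total L v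
  vertexSum-Y L {v} sv = Σℤ-+ λ e → trans
    (cong₂ ℤ._-_ (arrow-own (label L) sv e) (arrow-other (label L) (Bool.not-¬ sv) e))
    (ℤ.+-identityʳ _)

  vertexSum-X : ∀ L {v} → side v ≡ true → vertexSum G orientation (L ⟨$⟩ʳ_) v ≡ ℤ.- ℤ.+ total L v
  vertexSum-X L {v} sv = Σℤ-neg λ e → trans
    (cong₂ ℤ._-_ (arrow-other (label L) (Bool.not-¬ sv) e) (arrow-own (label L) sv e))
    (ℤ.+-identityˡ _)

  -- The edge `e` has an end on each side, and regularity carries the positive degree of that end to
  -- all of its side.
  count-positive : ∀ e → (∀ u v → side u ≡ side v → count (at u) ≡ count (at v)) → ∀ v → 0 < count (at v)
  count-positive e regular v = subst (0 <_) (regular u v (side-end (side v) e))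
    (≤-trans (≤-reflexive (sym (restrict-at (const 1) (cong (λ β → end β e) (side-end (side v) e)))))
      (≤-Σ (restrict (at u) (const 1)) e))
    where
    u : Fin n
    u = end (side v) e

  antimagic : ∀ L → (∀ v → 0 < count (at v)) → (∀ v w → side v ≡ side w → total L v ≡ total L w → v ≡ w) →
    IsAntimagicLabeling G orientation (↔⇒⤖ L)
  antimagic L pos inj v w eq with side v in sv | side w in sw
  ... | true  | true  = inj v w (trans sv (sym sw)) (ℤ.+-injective (ℤ.neg-injective
                          (trans (sym (vertexSum-X L sv)) (trans eq (vertexSum-X L sw)))))
  ... | false | false = inj v w (trans sv (sym sw)) (ℤ.+-injective
                          (trans (sym (vertexSum-Y L sv)) (trans eq (vertexSum-Y L sw))))
  ... | true  | false = contradiction (trans (sym (vertexSum-X L sv)) (trans eq (vertexSum-Y L sw)))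
                          (-a≢b (total-positive L v (pos v)))
  ... | false | true  = contradiction (trans (sym (vertexSum-X L sw)) (trans (sym eq) (vertexSum-Y L sv)))
                          (-a≢b (total-positive L w (pos w)))

theorem1 : ∀ {n m} (G : Graph n m) (side : Fin n → Bool) →
    IsSimple G → m ≥ 1 → IsBipartition G side → IsBiregular G side →
    HasAntimagicOrientation G
theorem1 {m = suc _} G side _ _ bipartition biregular =
  let L , inj = distinct-totals regular pos in orientation , ↔⇒⤖ L , antimagic L pos inj
  where
  open FromXToY G side bipartition
  open Bipartite side end side-end
  regular : ∀ u v → side u ≡ side v → count (at u) ≡ count (at v)
  regular u v eq = trans (count-at u) (trans (biregular u v eq) (sym (count-at v)))
  pos : ∀ v → 0 < count (at v)
  -- `m` is a successor, so there is an edge `zero` to serve as witness.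
  pos = count-positive zero regular
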